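{- Let $n, m, k$ be positive integers, let $f : \mathbb{B}^n \to \mathbb{B}^m$ and $g : \mathbb{B}^m \to \mathbb{B}^k$ be Boolean functions, and let $\phi(x,y,z) = (x, y \oplus f(x), z)$ and $\gamma(x,y,z) = (x, y, z \oplus g(y))$ on $\mathbb{B}^{n+m+k}$. Let $G_{2s}$ be the subgroup of $G(\mathbb{B}^{n+m+k})$ generated by $\phi$ and $\gamma$. For $\psi \in G_{2s}$ let $U_\psi$ be the linear operator on $\otimes^{n+m+k}\mathbb{C}^2$ determined on the computational basis by $U_\psi |x\rangle|y\rangle|z\rangle = |x'\rangle|y'\rangle|z'\rangle$, where $(x',y',z') = \psi(x,y,z)$. Then the mapping $\psi \mapsto U_\psi$ is a unitary representation of the group $G_{2s}$ in the unitary group of the tensor-product space $\otimes^{n+m+k}\mathbb{C}^2$.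
   Context: $\mathbb{B} = \{0,1\}$, and $\oplus$ denotes (componentwise) Boolean exclusive-or. $G(\mathbb{B}^p)$ is the group, under functional composition, of invertible functions $\mathbb{B}^p \to \mathbb{B}^p$, with identity $e$. The group $G_{2s}$ is $\{e, \phi, \gamma, \phi \circ \gamma, (\phi \circ \gamma)^2, (\phi \circ \gamma)^3, \phi \circ (\gamma \circ \phi), \gamma \circ (\phi \circ \gamma)\}$. The space $\otimes^{n+m+k}\mathbb{C}^2$ carries its standard Hermitian inner product, for which the computational basis $\{|x\rangle|y\rangle|z\rangle : x \in \mathbb{B}^n, y \in \mathbb{B}^m, z \in \mathbb{B}^k\}$ is orthonormal. -}

module Defs where

open import Algebra.Bundles using (CommutativeRing; Group)
open import Algebra.Module.Bundles using (LeftModule)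
open import Algebra.Module.Morphism.Structures using (module LeftModuleMorphisms)
import Algebra.Module.Morphism.Construct.Composition as Composition
import Algebra.Module.Morphism.Construct.Identity as Identity
import Algebra.Construct.Pointwise as Pointwise
open import Algebra.Morphism.Structures using (IsGroupHomomorphism)
import Algebra.Properties.CommutativeSemigroup as CommutativeSemigroupProperties
import Algebra.Properties.Ring as RingProperties
open import Algebra.Structures using (IsCommutativeRing)
open import Data.Bool.Base using (Bool; true; false; _xor_; if_then_else_)
import Data.Bool.Properties as Bool
open import Data.Nat.Base as ℕ using (ℕ; zero; suc)
import Data.Nat.Properties as ℕ
open import Data.Product.Base using (∃; _×_; _,_; proj₁; proj₂)
open import Data.Rational.Base as ℚ using (ℚ; 0ℚ; 1ℚ; ½)
import Data.Rational.Properties as ℚ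
open import Data.Rational.Solver using (module +-*-Solver)
open import Data.Sum.Base using (_⊎_; inj₁; inj₂)
open import Data.Vec.Base using (Vec; []; _∷_; _++_; take; drop; zipWith)
import Data.Vec.Properties as Vec
open import Function.Base using (_∘_; id)
open import Function.Bundles using (_↔_; mk↔ₛ′; module Inverse)
open import Function.Construct.Composition using (_↔-∘_)
open import Function.Construct.Identity using (↔-id)
open import Function.Construct.Symmetry using (↔-sym)
open import Level using (_⊔_; 0ℓ)
open import Relation.Binary.PropositionalEquality
  using (_≡_; _≢_; _≗_; refl; sym; trans; cong; cong₂; subst; module ≡-Reasoning)
open import Relation.Nullary.Decidable using (does)
open import Relation.Nullary.Negation using (contradiction)
open import Relation.Unary using (Pred)

private
  open +-*-Solver using (solve; _:=_; _:+_; _:*_; _:-_; :-_)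

-- `Vanishes d s`: the family s tends to 0 as d tends to infinity.  The
-- case d = id is that of a null sequence, the case d (m , n) = m ⊓ n
-- that of a double sequence.

record Vanishes {I : Set} (d : I → ℕ) (s : I → ℚ) : Set where
  constructor vanishes
  field
    tail : ∀ ε → 0ℚ ℚ.< ε → ∃ λ N → ∀ i → N ℕ.≤ d i → ℚ.∣ s i ∣ ℚ.< ε

open Vanishes

Null : (ℕ → ℚ) → Set
Null = Vanishes (λ n → n)

Cauchy : (ℕ → ℚ) → Set
Cauchy s = Vanishes {ℕ × ℕ} (λ (m , n) → m ℕ.⊓ n) (λ (m , n) → s m ℚ.- s n)

-- Cauchy sequences of rationals, with explicit moduli of convergence,
-- identified when their difference is a null sequence.

record ℝ : Set where
  constructor mkℝ
  field
    seq    : ℕ → ℚ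
    cauchy : Cauchy seq

open ℝ

infix 4 _≃_

record _≃_ (x y : ℝ) : Set where
  constructor mk≃
  field
    difference-null : Null (λ n → seq x n ℚ.- seq y n)

open _≃_

private

  record Bounded {I : Set} (d : I → ℕ) (s : I → ℚ) : Set where
    constructor bounded
    field
      B   : ℚ
      B>0 : ℚ.Positive B
      N   : ℕ
      s≤B : ∀ i → N ℕ.≤ d i → ℚ.∣ s i ∣ ℚ.≤ B

private abstract

  0<p*ε : ∀ p .{{_ : ℚ.Positive p}} {ε} → 0ℚ ℚ.< ε → 0ℚ ℚ.< p ℚ.* ε
  0<p*ε p {ε} ε>0 = subst (ℚ._< p ℚ.* ε) (ℚ.*-zeroʳ p) (ℚ.*-monoʳ-<-pos p ε>0)

  module _ {I : Set} {d : I → ℕ} where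

    vanishes-≗ : ∀ {s t} → (∀ i → s i ≡ t i) → Vanishes d s → Vanishes d t
    vanishes-≗ s≗t (vanishes s→0) = vanishes λ ε ε>0 → let N , p = s→0 ε ε>0 in
      N , λ i N≤i → subst (λ q → ℚ.∣ q ∣ ℚ.< ε) (s≗t i) (p i N≤i)

    vanishes-0 : Vanishes d (λ _ → 0ℚ)
    vanishes-0 = vanishes λ ε ε>0 → 0 , λ _ _ → ε>0

    vanishes-neg : ∀ {s} → Vanishes d s → Vanishes d (λ i → ℚ.- s i)
    vanishes-neg {s} (vanishes s→0) = vanishes λ ε ε>0 → let N , p = s→0 ε ε>0 in
      N , λ i N≤i → subst (ℚ._< ε) (sym (ℚ.∣-p∣≡∣p∣ (s i))) (p i N≤i)

    vanishes-+ : ∀ {s t} → Vanishes d s → Vanishes d t →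
                 Vanishes d (λ i → s i ℚ.+ t i)
    vanishes-+ {s} {t} (vanishes s→0) (vanishes t→0) = vanishes λ ε ε>0 →
      let N , p = s→0 (½ ℚ.* ε) (0<p*ε ½ ε>0)
          M , q = t→0 (½ ℚ.* ε) (0<p*ε ½ ε>0)
      in N ℕ.⊔ M , λ i N⊔M≤i → begin-strict
        ℚ.∣ s i ℚ.+ t i ∣        ≤⟨ ℚ.∣p+q∣≤∣p∣+∣q∣ (s i) (t i) ⟩
        ℚ.∣ s i ∣ ℚ.+ ℚ.∣ t i ∣  <⟨ ℚ.+-mono-< (p i (ℕ.m⊔n≤o⇒m≤o N M N⊔M≤i))
                                              (q i (ℕ.m⊔n≤o⇒n≤o N M N⊔M≤i)) ⟩
        ½ ℚ.* ε ℚ.+ ½ ℚ.* ε      ≡⟨ ℚ.*-distribʳ-+ ε ½ ½ ⟨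
        1ℚ ℚ.* ε                 ≡⟨ ℚ.*-identityˡ ε ⟩
        ε                        ∎
      where open ℚ.≤-Reasoning

    vanishes-* : ∀ {s t} → Bounded d s → Vanishes d t →
                 Vanishes d (λ i → s i ℚ.* t i)
    vanishes-* {s} {t} (bounded B B>0 N p) (vanishes t→0) =
      vanishes λ ε ε>0 → go B {{B>0}} p ε ε>0
      where
      open ℚ.≤-Reasoning
      go : ∀ B .{{_ : ℚ.Positive B}} →
           (∀ i → N ℕ.≤ d i → ℚ.∣ s i ∣ ℚ.≤ B) →
           ∀ ε → 0ℚ ℚ.< ε →
           ∃ λ K → ∀ i → K ℕ.≤ d i → ℚ.∣ s i ℚ.* t i ∣ ℚ.< ε
      go B p ε ε>0 =
        let instance _ = ℚ.pos⇒nonZero B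
            M , q = t→0 (ℚ.1/ B ℚ.* ε) (0<p*ε (ℚ.1/ B) {{ℚ.1/pos⇒pos B}} ε>0)
        in N ℕ.⊔ M , λ i N⊔M≤i → begin-strict
          ℚ.∣ s i ℚ.* t i ∣        ≡⟨ ℚ.∣p*q∣≡∣p∣*∣q∣ (s i) (t i) ⟩
          ℚ.∣ s i ∣ ℚ.* ℚ.∣ t i ∣  ≤⟨ ℚ.*-monoʳ-≤-nonNeg ℚ.∣ t i ∣ {{ℚ.∣-∣-nonNeg (t i)}}
                                       (p i (ℕ.m⊔n≤o⇒m≤o N M N⊔M≤i)) ⟩
          B ℚ.* ℚ.∣ t i ∣          <⟨ ℚ.*-monoʳ-<-pos B (q i (ℕ.m⊔n≤o⇒n≤o N M N⊔M≤i)) ⟩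
          B ℚ.* (ℚ.1/ B ℚ.* ε)     ≡⟨ ℚ.*-assoc B (ℚ.1/ B) ε ⟨
          B ℚ.* ℚ.1/ B ℚ.* ε       ≡⟨ cong (ℚ._* ε) (ℚ.*-inverseʳ B) ⟩
          1ℚ ℚ.* ε                 ≡⟨ ℚ.*-identityˡ ε ⟩
          ε                        ∎

  bounded-seq : ∀ x → Bounded (λ n → n) (seq x)
  bounded-seq (mkℝ s s-cauchy) with N , p ← tail s-cauchy 1ℚ (ℚ.positive⁻¹ 1ℚ) =
    bounded (ℚ.∣ s N ∣ ℚ.+ 1ℚ)
    (ℚ.nonNeg+pos⇒pos ℚ.∣ s N ∣ {{ℚ.∣-∣-nonNeg (s N)}} 1ℚ)
    N λ n N≤n → begin
      ℚ.∣ s n ∣                             ≡⟨ cong ℚ.∣_∣ (split (s n) (s N)) ⟩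
      ℚ.∣ s N ℚ.+ (s n ℚ.- s N) ∣           ≤⟨ ℚ.∣p+q∣≤∣p∣+∣q∣ (s N) (s n ℚ.- s N) ⟩
      ℚ.∣ s N ∣ ℚ.+ ℚ.∣ s n ℚ.- s N ∣       ≤⟨ ℚ.+-monoʳ-≤ ℚ.∣ s N ∣
                                               (ℚ.<⇒≤ (p (n , N) (ℕ.⊓-glb N≤n ℕ.≤-refl))) ⟩
      ℚ.∣ s N ∣ ℚ.+ 1ℚ                      ∎
    where
    open ℚ.≤-Reasoning
    split : ∀ a b → a ≡ b ℚ.+ (a ℚ.- b)
    split = solve 2 (λ a b → a := b :+ (a :- b)) refl

  bounded-fst : ∀ {s} → Bounded (λ n → n) s →
                Bounded {ℕ × ℕ} (λ (m , n) → m ℕ.⊓ n) (λ (m , n) → s m)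
  bounded-fst (bounded B B>0 N p) =
    bounded B B>0 N λ (m , n) N≤m⊓n → p m (ℕ.m≤n⊓o⇒m≤n m n N≤m⊓n)

  bounded-snd : ∀ {s} → Bounded (λ n → n) s →
                Bounded {ℕ × ℕ} (λ (m , n) → m ℕ.⊓ n) (λ (m , n) → s n)
  bounded-snd (bounded B B>0 N p) =
    bounded B B>0 N λ (m , n) N≤m⊓n → p n (ℕ.m≤n⊓o⇒m≤o m n N≤m⊓n)

  -‿+-interchange : ∀ a b c d →
    (a ℚ.- b) ℚ.+ (c ℚ.- d) ≡ (a ℚ.+ c) ℚ.- (b ℚ.+ d)
  -‿+-interchange = solve 4
    (λ a b c d → (a :- b) :+ (c :- d) := (a :+ c) :- (b :+ d)) refl

  -‿* : ∀ a b c d →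
    a ℚ.* (c ℚ.- d) ℚ.+ d ℚ.* (a ℚ.- b) ≡ a ℚ.* c ℚ.- b ℚ.* d
  -‿* = solve 4
    (λ a b c d → a :* (c :- d) :+ d :* (a :- b) := a :* c :- b :* d) refl

  -‿neg : ∀ a b → ℚ.- (a ℚ.- b) ≡ (ℚ.- a) ℚ.- (ℚ.- b)
  -‿neg = solve 2 (λ a b → :- (a :- b) := (:- a) :- (:- b)) refl

  -‿swap : ∀ a b → ℚ.- (a ℚ.- b) ≡ b ℚ.- a
  -‿swap = solve 2 (λ a b → :- (a :- b) := b :- a) refl

  -‿telescope : ∀ a b c → (a ℚ.- b) ℚ.+ (b ℚ.- c) ≡ a ℚ.- c
  -‿telescope = solve 3 (λ a b c → (a :- b) :+ (b :- c) := a :- c) refl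

infixl 6 _+ᴿ_
infixl 7 _*ᴿ_
infix  8 -ᴿ_

-- Opaque so that unification does not look inside sums and products.

opaque

  fromℚ : ℚ → ℝ
  fromℚ q = mkℝ (λ _ → q)
    (vanishes-≗ (λ _ → sym (ℚ.+-inverseʳ q)) vanishes-0)

  _+ᴿ_ _*ᴿ_ : ℝ → ℝ → ℝ
  x +ᴿ y = mkℝ (λ n → seq x n ℚ.+ seq y n)
    (vanishes-≗
      (λ (m , n) → -‿+-interchange (seq x m) (seq x n) (seq y m) (seq y n))
      (vanishes-+ (cauchy x) (cauchy y)))
  x *ᴿ y = mkℝ (λ n → seq x n ℚ.* seq y n)
    (vanishes-≗
      (λ (m , n) → -‿* (seq x m) (seq x n) (seq y m) (seq y n))
      (vanishes-+
        (vanishes-* (bounded-fst (bounded-seq x)) (cauchy y))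
        (vanishes-* (bounded-snd (bounded-seq y)) (cauchy x))))

  -ᴿ_ : ℝ → ℝ
  -ᴿ x = mkℝ (λ n → ℚ.- seq x n)
    (vanishes-≗ (λ (m , n) → -‿neg (seq x m) (seq x n)) (vanishes-neg (cauchy x)))

opaque
  unfolding fromℚ _+ᴿ_ _*ᴿ_ -ᴿ_

  private

    ≗⇒≃ : ∀ {x y} → (∀ n → seq x n ≡ seq y n) → x ≃ y
    ≗⇒≃ {x} {y} x≗y = mk≃ (vanishes-≗
      (λ n → sym (trans (cong (ℚ._- seq y n) (x≗y n)) (ℚ.+-inverseʳ (seq y n))))
      vanishes-0)

    ≃-sym : ∀ {x y} → x ≃ y → y ≃ x
    ≃-sym {x} {y} (mk≃ x≃y) = mk≃
      (vanishes-≗ (λ n → -‿swap (seq x n) (seq y n)) (vanishes-neg x≃y))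

    ≃-trans : ∀ {x y z} → x ≃ y → y ≃ z → x ≃ z
    ≃-trans {x} {y} {z} (mk≃ x≃y) (mk≃ y≃z) = mk≃
      (vanishes-≗ (λ n → -‿telescope (seq x n) (seq y n) (seq z n))
        (vanishes-+ x≃y y≃z))

    +ᴿ-cong : ∀ {x y u v} → x ≃ y → u ≃ v → x +ᴿ u ≃ y +ᴿ v
    +ᴿ-cong {x} {y} {u} {v} (mk≃ x≃y) (mk≃ u≃v) = mk≃
      (vanishes-≗ (λ n → -‿+-interchange (seq x n) (seq y n) (seq u n) (seq v n))
        (vanishes-+ x≃y u≃v))

    *ᴿ-cong : ∀ {x y u v} → x ≃ y → u ≃ v → x *ᴿ u ≃ y *ᴿ v
    *ᴿ-cong {x} {y} {u} {v} (mk≃ x≃y) (mk≃ u≃v) = mk≃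
      (vanishes-≗ (λ n → -‿* (seq x n) (seq y n) (seq u n) (seq v n))
        (vanishes-+ (vanishes-* (bounded-seq x) u≃v)
                    (vanishes-* (bounded-seq v) x≃y)))

    -ᴿ-cong : ∀ {x y} → x ≃ y → -ᴿ x ≃ -ᴿ y
    -ᴿ-cong {x} {y} (mk≃ x≃y) = mk≃
      (vanishes-≗ (λ n → -‿neg (seq x n) (seq y n)) (vanishes-neg x≃y))

  ℝ-isCommutativeRing : IsCommutativeRing _≃_ _+ᴿ_ _*ᴿ_ -ᴿ_ (fromℚ 0ℚ) (fromℚ 1ℚ)
  ℝ-isCommutativeRing = record
    { isRing = record
      { +-isAbelianGroup = record
        { isGroup = record
          { isMonoid = record
            { isSemigroup = record
              { isMagma = record
                { isEquivalence = record
                  { refl  = ≗⇒≃ λ _ → refl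
                  ; sym   = ≃-sym
                  ; trans = ≃-trans
                  }
                ; ∙-cong = +ᴿ-cong
                }
              ; assoc = λ x y z → ≗⇒≃ λ n → ℚ.+-assoc (seq x n) (seq y n) (seq z n)
              }
            ; identity = (λ x → ≗⇒≃ λ n → ℚ.+-identityˡ (seq x n))
                       , (λ x → ≗⇒≃ λ n → ℚ.+-identityʳ (seq x n))
            }
          ; inverse = (λ x → ≗⇒≃ λ n → ℚ.+-inverseˡ (seq x n))
                    , (λ x → ≗⇒≃ λ n → ℚ.+-inverseʳ (seq x n))
          ; ⁻¹-cong = -ᴿ-cong
          }
        ; comm = λ x y → ≗⇒≃ λ n → ℚ.+-comm (seq x n) (seq y n)
        }
      ; *-cong = *ᴿ-cong
      ; *-assoc = λ x y z → ≗⇒≃ λ n → ℚ.*-assoc (seq x n) (seq y n) (seq z n)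
      ; *-identity = (λ x → ≗⇒≃ λ n → ℚ.*-identityˡ (seq x n))
                   , (λ x → ≗⇒≃ λ n → ℚ.*-identityʳ (seq x n))
      ; distrib = (λ x y z → ≗⇒≃ λ n → ℚ.*-distribˡ-+ (seq x n) (seq y n) (seq z n))
                , (λ x y z → ≗⇒≃ λ n → ℚ.*-distribʳ-+ (seq x n) (seq y n) (seq z n))
      }
    ; *-comm = λ x y → ≗⇒≃ λ n → ℚ.*-comm (seq x n) (seq y n)
    }

ℝ-commutativeRing : CommutativeRing 0ℓ 0ℓ
ℝ-commutativeRing = record { isCommutativeRing = ℝ-isCommutativeRing }

infix 5 _+i_

record ℂ : Set where
  constructor _+i_
  field
    re im : ℝ

open ℂ

infix 4 _≃ᶜ_

record _≃ᶜ_ (z w : ℂ) : Set where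
  constructor mk≃ᶜ
  field
    re-≃ : re z ≃ re w
    im-≃ : im z ≃ im w

open _≃ᶜ_

infixl 6 _+ᶜ_
infixl 7 _*ᶜ_
infix  8 -ᶜ_

opaque

  0ᶜ 1ᶜ : ℂ
  0ᶜ = fromℚ 0ℚ +i fromℚ 0ℚ
  1ᶜ = fromℚ 1ℚ +i fromℚ 0ℚ

  _+ᶜ_ _*ᶜ_ : ℂ → ℂ → ℂ
  (a +i b) +ᶜ (c +i d) = (a +ᴿ c) +i (b +ᴿ d)
  (a +i b) *ᶜ (c +i d) = (a *ᴿ c +ᴿ -ᴿ (b *ᴿ d)) +i (a *ᴿ d +ᴿ b *ᴿ c)

  -ᶜ_ conj : ℂ → ℂ
  -ᶜ (a +i b)   = (-ᴿ a) +i (-ᴿ b)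
  conj (a +i b) = a +i (-ᴿ b)

private
  module ℝ-ring = CommutativeRing ℝ-commutativeRing

opaque
  unfolding _+ᴿ_ _*ᴿ_ -ᴿ_

  private

    assoc-re : ∀ a b c d e f →
      (a *ᴿ c +ᴿ -ᴿ (b *ᴿ d)) *ᴿ e +ᴿ -ᴿ ((a *ᴿ d +ᴿ b *ᴿ c) *ᴿ f) ≃
      a *ᴿ (c *ᴿ e +ᴿ -ᴿ (d *ᴿ f)) +ᴿ -ᴿ (b *ᴿ (c *ᴿ f +ᴿ d *ᴿ e))
    assoc-re a b c d e f = ≗⇒≃ λ n → solve 6 (λ a b c d e f →
      (a :* c :+ :- (b :* d)) :* e :+ :- ((a :* d :+ b :* c) :* f) :=
      a :* (c :* e :+ :- (d :* f)) :+ :- (b :* (c :* f :+ d :* e)))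
      refl (seq a n) (seq b n) (seq c n) (seq d n) (seq e n) (seq f n)

    assoc-im : ∀ a b c d e f →
      (a *ᴿ c +ᴿ -ᴿ (b *ᴿ d)) *ᴿ f +ᴿ (a *ᴿ d +ᴿ b *ᴿ c) *ᴿ e ≃
      a *ᴿ (c *ᴿ f +ᴿ d *ᴿ e) +ᴿ b *ᴿ (c *ᴿ e +ᴿ -ᴿ (d *ᴿ f))
    assoc-im a b c d e f = ≗⇒≃ λ n → solve 6 (λ a b c d e f →
      (a :* c :+ :- (b :* d)) :* f :+ (a :* d :+ b :* c) :* e :=
      a :* (c :* f :+ d :* e) :+ b :* (c :* e :+ :- (d :* f)))
      refl (seq a n) (seq b n) (seq c n) (seq d n) (seq e n) (seq f n)

    comm-im : ∀ a b c d →
      a *ᴿ d +ᴿ b *ᴿ c ≃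
      c *ᴿ b +ᴿ d *ᴿ a
    comm-im a b c d = ≗⇒≃ λ n → solve 4 (λ a b c d →
      a :* d :+ b :* c :=
      c :* b :+ d :* a)
      refl (seq a n) (seq b n) (seq c n) (seq d n)

    distrib-re : ∀ a b c d e f →
      a *ᴿ (c +ᴿ e) +ᴿ -ᴿ (b *ᴿ (d +ᴿ f)) ≃
      (a *ᴿ c +ᴿ -ᴿ (b *ᴿ d)) +ᴿ (a *ᴿ e +ᴿ -ᴿ (b *ᴿ f))
    distrib-re a b c d e f = ≗⇒≃ λ n → solve 6 (λ a b c d e f →
      a :* (c :+ e) :+ :- (b :* (d :+ f)) :=
      (a :* c :+ :- (b :* d)) :+ (a :* e :+ :- (b :* f)))
      refl (seq a n) (seq b n) (seq c n) (seq d n) (seq e n) (seq f n)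

    distrib-im : ∀ a b c d e f →
      a *ᴿ (d +ᴿ f) +ᴿ b *ᴿ (c +ᴿ e) ≃
      (a *ᴿ d +ᴿ b *ᴿ c) +ᴿ (a *ᴿ f +ᴿ b *ᴿ e)
    distrib-im a b c d e f = ≗⇒≃ λ n → solve 6 (λ a b c d e f →
      a :* (d :+ f) :+ b :* (c :+ e) :=
      (a :* d :+ b :* c) :+ (a :* f :+ b :* e))
      refl (seq a n) (seq b n) (seq c n) (seq d n) (seq e n) (seq f n)

opaque
  unfolding 0ᶜ _+ᶜ_ -ᶜ_

  private

    *ᶜ-assoc : ∀ z w v → (z *ᶜ w) *ᶜ v ≃ᶜ z *ᶜ (w *ᶜ v)
    *ᶜ-assoc (a +i b) (c +i d) (e +i f) =
      mk≃ᶜ (assoc-re a b c d e f) (assoc-im a b c d e f)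

    *ᶜ-comm : ∀ z w → z *ᶜ w ≃ᶜ w *ᶜ z
    *ᶜ-comm (a +i b) (c +i d) = mk≃ᶜ
      (ℝ-ring.+-cong (ℝ-ring.*-comm a c) (ℝ-ring.-‿cong (ℝ-ring.*-comm b d)))
      (comm-im a b c d)

    *ᶜ-distribˡ-+ᶜ : ∀ z w v → z *ᶜ (w +ᶜ v) ≃ᶜ z *ᶜ w +ᶜ z *ᶜ v
    *ᶜ-distribˡ-+ᶜ (a +i b) (c +i d) (e +i f) =
      mk≃ᶜ (distrib-re a b c d e f) (distrib-im a b c d e f)

    ≃ᶜ-refl : ∀ {z} → z ≃ᶜ z
    ≃ᶜ-refl = mk≃ᶜ ℝ-ring.refl ℝ-ring.refl

    ≃ᶜ-sym : ∀ {z w} → z ≃ᶜ w → w ≃ᶜ z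
    ≃ᶜ-sym (mk≃ᶜ p q) = mk≃ᶜ (ℝ-ring.sym p) (ℝ-ring.sym q)

    ≃ᶜ-trans : ∀ {z w v} → z ≃ᶜ w → w ≃ᶜ v → z ≃ᶜ v
    ≃ᶜ-trans (mk≃ᶜ p q) (mk≃ᶜ r s) = mk≃ᶜ (ℝ-ring.trans p r) (ℝ-ring.trans q s)

    +ᶜ-cong : ∀ {z w u v} → z ≃ᶜ w → u ≃ᶜ v → z +ᶜ u ≃ᶜ w +ᶜ v
    +ᶜ-cong (mk≃ᶜ p q) (mk≃ᶜ r s) = mk≃ᶜ (ℝ-ring.+-cong p r) (ℝ-ring.+-cong q s)

    *ᶜ-cong : ∀ {z w u v} → z ≃ᶜ w → u ≃ᶜ v → z *ᶜ u ≃ᶜ w *ᶜ v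
    *ᶜ-cong (mk≃ᶜ p q) (mk≃ᶜ r s) = mk≃ᶜ
      (ℝ-ring.+-cong (ℝ-ring.*-cong p r) (ℝ-ring.-‿cong (ℝ-ring.*-cong q s)))
      (ℝ-ring.+-cong (ℝ-ring.*-cong p s) (ℝ-ring.*-cong q r))

    -ᶜ-cong : ∀ {z w} → z ≃ᶜ w → -ᶜ z ≃ᶜ -ᶜ w
    -ᶜ-cong (mk≃ᶜ p q) = mk≃ᶜ (ℝ-ring.-‿cong p) (ℝ-ring.-‿cong q)

    +ᶜ-identityˡ : ∀ z → 0ᶜ +ᶜ z ≃ᶜ z
    +ᶜ-identityˡ z = mk≃ᶜ (ℝ-ring.+-identityˡ (re z)) (ℝ-ring.+-identityˡ (im z))

    +ᶜ-inverseˡ : ∀ z → (-ᶜ z) +ᶜ z ≃ᶜ 0ᶜ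
    +ᶜ-inverseˡ z = mk≃ᶜ (ℝ-ring.-‿inverseˡ (re z)) (ℝ-ring.-‿inverseˡ (im z))

    +ᶜ-assoc : ∀ z w v → (z +ᶜ w) +ᶜ v ≃ᶜ z +ᶜ (w +ᶜ v)
    +ᶜ-assoc z w v =
      mk≃ᶜ (ℝ-ring.+-assoc (re z) (re w) (re v)) (ℝ-ring.+-assoc (im z) (im w) (im v))

    +ᶜ-comm : ∀ z w → z +ᶜ w ≃ᶜ w +ᶜ z
    +ᶜ-comm z w = mk≃ᶜ (ℝ-ring.+-comm (re z) (re w)) (ℝ-ring.+-comm (im z) (im w))

    *ᶜ-identityˡ : ∀ z → 1ᶜ *ᶜ z ≃ᶜ z
    *ᶜ-identityˡ (a +i b) = mk≃ᶜ
      (begin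
        1ᴿ *ᴿ a +ᴿ -ᴿ (0ᴿ *ᴿ b)  ≈⟨ ℝ-ring.+-cong (ℝ-ring.*-identityˡ a) (ℝ-ring.-‿cong (ℝ-ring.zeroˡ b)) ⟩
        a +ᴿ -ᴿ 0ᴿ               ≈⟨ ℝ-ring.+-congˡ -0#≈0# ⟩
        a +ᴿ 0ᴿ                  ≈⟨ ℝ-ring.+-identityʳ a ⟩
        a                        ∎)
      (begin
        1ᴿ *ᴿ b +ᴿ 0ᴿ *ᴿ a       ≈⟨ ℝ-ring.+-cong (ℝ-ring.*-identityˡ b) (ℝ-ring.zeroˡ a) ⟩
        b +ᴿ 0ᴿ                  ≈⟨ ℝ-ring.+-identityʳ b ⟩
        b                        ∎)
      where
      open import Relation.Binary.Reasoning.Setoid ℝ-ring.setoid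
      open RingProperties ℝ-ring.ring using (-0#≈0#)
      0ᴿ 1ᴿ : ℝ
      0ᴿ = fromℚ 0ℚ
      1ᴿ = fromℚ 1ℚ

  ℂ-isCommutativeRing : IsCommutativeRing _≃ᶜ_ _+ᶜ_ _*ᶜ_ -ᶜ_ 0ᶜ 1ᶜ
  ℂ-isCommutativeRing = record
    { isRing = record
      { +-isAbelianGroup = record
        { isGroup = record
          { isMonoid = record
            { isSemigroup = record
              { isMagma = record
                { isEquivalence = record
                  { refl = ≃ᶜ-refl ; sym = ≃ᶜ-sym ; trans = ≃ᶜ-trans }
                ; ∙-cong = +ᶜ-cong
                }
              ; assoc = +ᶜ-assoc
              }
            ; identity = +ᶜ-identityˡ
                       , λ z → ≃ᶜ-trans (+ᶜ-comm z 0ᶜ) (+ᶜ-identityˡ z)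
            }
          ; inverse = +ᶜ-inverseˡ
                    , λ z → ≃ᶜ-trans (+ᶜ-comm z (-ᶜ z)) (+ᶜ-inverseˡ z)
          ; ⁻¹-cong = -ᶜ-cong
          }
        ; comm = +ᶜ-comm
        }
      ; *-cong = *ᶜ-cong
      ; *-assoc = *ᶜ-assoc
      ; *-identity = *ᶜ-identityˡ
                   , λ z → ≃ᶜ-trans (*ᶜ-comm z 1ᶜ) (*ᶜ-identityˡ z)
      ; distrib = *ᶜ-distribˡ-+ᶜ
                , λ z w v → ≃ᶜ-trans (*ᶜ-comm (w +ᶜ v) z)
                    (≃ᶜ-trans (*ᶜ-distribˡ-+ᶜ z w v)
                              (+ᶜ-cong (*ᶜ-comm z w) (*ᶜ-comm z v)))
      }
    ; *-comm = *ᶜ-comm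
    }

  conj-cong : ∀ {z w} → z ≃ᶜ w → conj z ≃ᶜ conj w
  conj-cong (mk≃ᶜ p q) = mk≃ᶜ p (ℝ-ring.-‿cong q)

  conj-0ᶜ : conj 0ᶜ ≃ᶜ 0ᶜ
  conj-0ᶜ = mk≃ᶜ ℝ-ring.refl (RingProperties.-0#≈0# ℝ-ring.ring)

  conj-1ᶜ : conj 1ᶜ ≃ᶜ 1ᶜ
  conj-1ᶜ = mk≃ᶜ ℝ-ring.refl (RingProperties.-0#≈0# ℝ-ring.ring)

ℂ-commutativeRing : CommutativeRing 0ℓ 0ℓ
ℂ-commutativeRing = record { isCommutativeRing = ℂ-isCommutativeRing }

open CommutativeRing ℂ-commutativeRing
  using (_≈_; _+_; _*_; -_; 0#; 1#)

private
  module ℂ-ring = CommutativeRing ℂ-commutativeRing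

𝔹 : ℕ → Set
𝔹 p = Vec Bool p

infixl 6 _⊕_

_⊕_ : ∀ {p} → 𝔹 p → 𝔹 p → 𝔹 p
_⊕_ = zipWith _xor_

∑ : ∀ {p} → (𝔹 p → ℂ) → ℂ
∑ {zero}  h = h []
∑ {suc p} h = ∑ (λ w → h (false ∷ w)) + ∑ (λ w → h (true ∷ w))

-- The p-fold tensor power of ℂ², in coordinates with respect to the
-- products of the basis vectors of the factors: v w is the amplitude
-- of v at the basis vector indexed by w.

⨂ℂ² : ℕ → Set
⨂ℂ² p = 𝔹 p → ℂ

infix 4 _≈ᵛ_

_≈ᵛ_ : ∀ {p} → ⨂ℂ² p → ⨂ℂ² p → Set
u ≈ᵛ v = ∀ w → u w ≈ v w

⨂ℂ²-leftModule : ℕ → LeftModule ℂ-ring.ring 0ℓ 0ℓ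
⨂ℂ²-leftModule p = record
  { Carrierᴹ = ⨂ℂ² p
  ; _≈ᴹ_ = _≈ᵛ_
  ; _+ᴹ_ = λ u v w → u w + v w
  ; _*ₗ_ = λ a v w → a * v w
  ; 0ᴹ   = λ _ → 0#
  ; -ᴹ_  = λ v w → - v w
  ; isLeftModule = record
    { isLeftSemimodule = record
      { +ᴹ-isCommutativeMonoid =
          Pointwise.isCommutativeMonoid (𝔹 p) ℂ-ring.+-isCommutativeMonoid
      ; isPreleftSemimodule = record
        { *ₗ-cong      = λ a≈b u≈v w → ℂ-ring.*-cong a≈b (u≈v w)
        ; *ₗ-zeroˡ     = λ v w → ℂ-ring.zeroˡ (v w)
        ; *ₗ-distribʳ  = λ v a b w → ℂ-ring.distribʳ (v w) a b
        ; *ₗ-identityˡ = λ v w → ℂ-ring.*-identityˡ (v w)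
        ; *ₗ-assoc     = λ a b v w → ℂ-ring.*-assoc a b (v w)
        ; *ₗ-zeroʳ     = λ a w → ℂ-ring.zeroʳ a
        ; *ₗ-distribˡ  = λ a u v w → ℂ-ring.distribˡ a (u w) (v w)
        }
      }
    ; -ᴹ‿cong    = λ u≈v w → ℂ-ring.-‿cong (u≈v w)
    ; -ᴹ‿inverse = (λ v w → ℂ-ring.-‿inverseˡ (v w))
                 , (λ v w → ℂ-ring.-‿inverseʳ (v w))
    }
  }

infixr 7 _⊗_

_⊗_ : ∀ {p q} → ⨂ℂ² p → ⨂ℂ² q → ⨂ℂ² (p ℕ.+ q)
_⊗_ {p} u v w = u (take p w) * v (drop p w)

qubit : Bool → ⨂ℂ² 1
qubit b (c ∷ []) = if does (b Bool.≟ c) then 1# else 0#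

infix 8 ∣_⟩

∣_⟩ : ∀ {p} → 𝔹 p → ⨂ℂ² p
∣ [] ⟩    = λ _ → 1#
∣ b ∷ w ⟩ = qubit b ⊗ ∣ w ⟩

⟨_,_⟩ : ∀ {p} → ⨂ℂ² p → ⨂ℂ² p → ℂ
⟨ u , v ⟩ = ∑ (λ w → conj (u w) * v w)

∑-cong : ∀ {p} {h k : 𝔹 p → ℂ} → (∀ w → h w ≈ k w) → ∑ h ≈ ∑ k
∑-cong {zero}  h≈k = h≈k []
∑-cong {suc p} h≈k =
  ℂ-ring.+-cong (∑-cong λ w → h≈k (false ∷ w)) (∑-cong λ w → h≈k (true ∷ w))

⟨⟩-cong : ∀ {p} {u u′ v v′ : ⨂ℂ² p} → u ≈ᵛ u′ → v ≈ᵛ v′ → ⟨ u , v ⟩ ≈ ⟨ u′ , v′ ⟩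
⟨⟩-cong u≈u′ v≈v′ = ∑-cong λ w → ℂ-ring.*-cong (conj-cong (u≈u′ w)) (v≈v′ w)

∣⟩-++ : ∀ {p q} (x : 𝔹 p) (y : 𝔹 q) → ∣ x ++ y ⟩ ≈ᵛ ∣ x ⟩ ⊗ ∣ y ⟩
∣⟩-++ []      y w       = ℂ-ring.sym (ℂ-ring.*-identityˡ _)
∣⟩-++ (b ∷ x) y (c ∷ w) =
  ℂ-ring.trans (ℂ-ring.*-congˡ (∣⟩-++ x y w)) (ℂ-ring.sym (ℂ-ring.*-assoc _ _ _))

∑-0 : ∀ {p} {h : 𝔹 p → ℂ} → (∀ w → h w ≈ 0#) → ∑ h ≈ 0#
∑-0 {zero}  h≈0 = h≈0 []
∑-0 {suc p} h≈0 = ℂ-ring.trans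
  (ℂ-ring.+-cong (∑-0 λ w → h≈0 (false ∷ w)) (∑-0 λ w → h≈0 (true ∷ w)))
  (ℂ-ring.+-identityˡ 0#)

∑-∣⟩ : ∀ {p} (x : 𝔹 p) (h : 𝔹 p → ℂ) → ∑ (λ w → ∣ x ⟩ w * h w) ≈ h x
∑-∣⟩ []          h = ℂ-ring.*-identityˡ (h [])
∑-∣⟩ (false ∷ x) h = ℂ-ring.trans
  (ℂ-ring.+-cong
    (ℂ-ring.trans
      (∑-cong λ w → ℂ-ring.*-congʳ (ℂ-ring.*-identityˡ (∣ x ⟩ w)))
      (∑-∣⟩ x (λ w → h (false ∷ w))))
    (∑-0 λ w → ℂ-ring.trans (ℂ-ring.*-congʳ (ℂ-ring.zeroˡ (∣ x ⟩ w)))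
                            (ℂ-ring.zeroˡ (h (true ∷ w)))))
  (ℂ-ring.+-identityʳ (h (false ∷ x)))
∑-∣⟩ (true ∷ x) h = ℂ-ring.trans
  (ℂ-ring.+-cong
    (∑-0 λ w → ℂ-ring.trans (ℂ-ring.*-congʳ (ℂ-ring.zeroˡ (∣ x ⟩ w)))
                            (ℂ-ring.zeroˡ (h (false ∷ w))))
    (ℂ-ring.trans
      (∑-cong λ w → ℂ-ring.*-congʳ (ℂ-ring.*-identityˡ (∣ x ⟩ w)))
      (∑-∣⟩ x (λ w → h (true ∷ w)))))
  (ℂ-ring.+-identityˡ (h (true ∷ x)))

∣⟩-same : ∀ {p} (x : 𝔹 p) → ∣ x ⟩ x ≈ 1#
∣⟩-same []          = ℂ-ring.refl
∣⟩-same (false ∷ x) = ℂ-ring.trans (ℂ-ring.*-identityˡ _) (∣⟩-same x)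
∣⟩-same (true  ∷ x) = ℂ-ring.trans (ℂ-ring.*-identityˡ _) (∣⟩-same x)

∣⟩-distinct : ∀ {p} (x y : 𝔹 p) → x ≢ y → ∣ x ⟩ y ≈ 0#
∣⟩-distinct []          []          x≢y = contradiction refl x≢y
∣⟩-distinct (false ∷ x) (true  ∷ y) x≢y = ℂ-ring.zeroˡ _
∣⟩-distinct (true  ∷ x) (false ∷ y) x≢y = ℂ-ring.zeroˡ _
∣⟩-distinct (false ∷ x) (false ∷ y) x≢y =
  ℂ-ring.trans (ℂ-ring.*-congˡ (∣⟩-distinct x y (x≢y ∘ cong (false ∷_)))) (ℂ-ring.zeroʳ _)
∣⟩-distinct (true  ∷ x) (true  ∷ y) x≢y =
  ℂ-ring.trans (ℂ-ring.*-congˡ (∣⟩-distinct x y (x≢y ∘ cong (true ∷_)))) (ℂ-ring.zeroʳ _)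

⟨∣⟩,∣⟩⟩ : ∀ {p} (x y : 𝔹 p) → ⟨ ∣ x ⟩ , ∣ y ⟩ ⟩ ≈ conj (∣ x ⟩ y)
⟨∣⟩,∣⟩⟩ x y = ℂ-ring.trans
  (∑-cong λ w → ℂ-ring.*-comm (conj (∣ x ⟩ w)) (∣ y ⟩ w))
  (∑-∣⟩ y (λ w → conj (∣ x ⟩ w)))

∣⟩-normalised : ∀ {p} (x : 𝔹 p) → ⟨ ∣ x ⟩ , ∣ x ⟩ ⟩ ≈ 1#
∣⟩-normalised x =
  ℂ-ring.trans (⟨∣⟩,∣⟩⟩ x x) (ℂ-ring.trans (conj-cong (∣⟩-same x)) conj-1ᶜ)

∣⟩-orthogonal : ∀ {p} (x y : 𝔹 p) → x ≢ y → ⟨ ∣ x ⟩ , ∣ y ⟩ ⟩ ≈ 0#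
∣⟩-orthogonal x y x≢y =
  ℂ-ring.trans (⟨∣⟩,∣⟩⟩ x y) (ℂ-ring.trans (conj-cong (∣⟩-distinct x y x≢y)) conj-0ᶜ)

module _ {p : ℕ} where
  open LeftModule (⨂ℂ²-leftModule p) using (rawLeftModule)
  open LeftModuleMorphisms rawLeftModule rawLeftModule public
    using () renaming
    ( IsLeftModuleHomomorphism to IsLinear
    ; IsLeftModuleIsomorphism  to IsLinearIsomorphism
    )

record IsUnitary {p} (T : ⨂ℂ² p → ⨂ℂ² p) : Set where
  field
    isLinearIsomorphism : IsLinearIsomorphism T
    ⟨⟩-homo             : ∀ u v → ⟨ T u , T v ⟩ ≈ ⟨ u , v ⟩

  open IsLinearIsomorphism isLinearIsomorphism public

unitaryGroup : ℕ → Group 0ℓ 0ℓ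
unitaryGroup p = record
  { Carrier = ∃ λ (T : ⨂ℂ² p → ⨂ℂ² p) → IsUnitary T
  ; _≈_     = λ (S , _) (T , _) → ∀ v → S v ≈ᵛ T v
  ; _∙_     = λ (S , S-unitary) (T , T-unitary) → S ∘ T , ∘-isUnitary S-unitary T-unitary
  ; ε       = id , id-isUnitary
  ; _⁻¹     = λ (T , T-unitary) → inverse T-unitary , inverse-isUnitary T-unitary
  ; isGroup = record
    { isMonoid = record
      { isSemigroup = record
        { isMagma = record
          { isEquivalence = record
            { refl  = λ _ → ≈ᴹ-refl
            ; sym   = λ S≈T v → ≈ᴹ-sym (S≈T v)
            ; trans = λ R≈S S≈T v → ≈ᴹ-trans (R≈S v) (S≈T v)
            }
          ; ∙-cong = λ {(S , S-unitary)} S≈S′ T≈T′ v →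
              ≈ᴹ-trans (IsUnitary.⟦⟧-cong S-unitary (T≈T′ v)) (S≈S′ _)
          }
        ; assoc = λ _ _ _ _ → ≈ᴹ-refl
        }
      ; identity = (λ _ _ → ≈ᴹ-refl) , (λ _ _ → ≈ᴹ-refl)
      }
    ; inverse = (λ (_ , T-unitary) v → inverse-leftInverse T-unitary v)
              , (λ (_ , T-unitary) v → inverse-rightInverse T-unitary v)
    ; ⁻¹-cong = λ {(S , S-unitary)} {(T , T-unitary)} S≈T v →
        IsUnitary.injective S-unitary
          (≈ᴹ-trans (inverse-rightInverse S-unitary v)
          (≈ᴹ-trans (≈ᴹ-sym (inverse-rightInverse T-unitary v))
                    (≈ᴹ-sym (S≈T (inverse T-unitary v)))))
    }
  }
  where
  open LeftModule (⨂ℂ²-leftModule p)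
    using (≈ᴹ-refl; ≈ᴹ-sym; ≈ᴹ-trans; +ᴹ-cong; *ₗ-cong; -ᴹ‿cong)

  id-isUnitary : IsUnitary {p} id
  id-isUnitary = record
    { isLinearIsomorphism = Identity.isLeftModuleIsomorphism _ ≈ᴹ-refl
    ; ⟨⟩-homo             = λ _ _ → ℂ-ring.refl
    }

  ∘-isUnitary : ∀ {S T : ⨂ℂ² p → ⨂ℂ² p} → IsUnitary S → IsUnitary T → IsUnitary (S ∘ T)
  ∘-isUnitary S-unitary T-unitary = record
    { isLinearIsomorphism = Composition.isLeftModuleIsomorphism ≈ᴹ-trans
        T.isLinearIsomorphism S.isLinearIsomorphism
    ; ⟨⟩-homo = λ u v → ℂ-ring.trans (S.⟨⟩-homo _ _) (T.⟨⟩-homo u v)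
    }
    where
    module S = IsUnitary S-unitary
    module T = IsUnitary T-unitary

  module _ {T : ⨂ℂ² p → ⨂ℂ² p} (T-unitary : IsUnitary T) where
    open IsUnitary T-unitary

    inverse : ⨂ℂ² p → ⨂ℂ² p
    inverse v = proj₁ (surjective v)

    inverse-rightInverse : ∀ v → T (inverse v) ≈ᵛ v
    inverse-rightInverse v = proj₂ (surjective v) ≈ᴹ-refl

    inverse-leftInverse : ∀ v → inverse (T v) ≈ᵛ v
    inverse-leftInverse v = injective (inverse-rightInverse (T v))

    inverse-unique : ∀ u {v} → v ≈ᵛ T u → inverse v ≈ᵛ u
    inverse-unique u {v} v≈Tu =
      injective (≈ᴹ-trans (inverse-rightInverse v) v≈Tu)

    inverse-cong : ∀ {u v} → u ≈ᵛ v → inverse u ≈ᵛ inverse v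
    inverse-cong {u} {v} u≈v =
      inverse-unique (inverse v) (≈ᴹ-trans u≈v (≈ᴹ-sym (inverse-rightInverse v)))

    inverse-isUnitary : IsUnitary inverse
    inverse-isUnitary = record
      { isLinearIsomorphism = record
        { isLeftModuleMonomorphism = record
          { isLeftModuleHomomorphism = record
            { +ᴹ-isGroupHomomorphism = record
              { isMonoidHomomorphism = record
                { isMagmaHomomorphism = record
                  { isRelHomomorphism = record { cong = inverse-cong }
                  ; homo = λ u v → inverse-unique _ (≈ᴹ-sym (≈ᴹ-trans (+ᴹ-homo _ _)
                      (+ᴹ-cong (inverse-rightInverse u) (inverse-rightInverse v))))
                  }
                ; ε-homo = inverse-unique _ (≈ᴹ-sym 0ᴹ-homo)
                }
              ; ⁻¹-homo = λ v → inverse-unique _ (≈ᴹ-sym (≈ᴹ-trans (-ᴹ-homo _)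
                  (-ᴹ‿cong (inverse-rightInverse v))))
              }
            ; *ₗ-homo = λ a v → inverse-unique _ (≈ᴹ-sym (≈ᴹ-trans (*ₗ-homo a _)
                (*ₗ-cong ℂ-ring.refl (inverse-rightInverse v))))
            }
          ; injective = λ {u} {v} T⁻¹u≈T⁻¹v →
              ≈ᴹ-trans (≈ᴹ-sym (inverse-rightInverse u))
              (≈ᴹ-trans (⟦⟧-cong T⁻¹u≈T⁻¹v) (inverse-rightInverse v))
          }
        ; surjective = λ v → T v , inverse-unique v
        }
      ; ⟨⟩-homo = λ u v → ℂ-ring.trans (ℂ-ring.sym (⟨⟩-homo _ _))
          (⟨⟩-cong (inverse-rightInverse u) (inverse-rightInverse v))
      }

record IsUnitaryRepresentation
  {c ℓ} (G : Group c ℓ) {p} (ρ : Group.Carrier G → ⨂ℂ² p → ⨂ℂ² p) : Set (c ⊔ ℓ) where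
  field
    isUnitary           : ∀ g → IsUnitary (ρ g)
    isGroupHomomorphism : IsGroupHomomorphism (Group.rawGroup G)
      (Group.rawGroup (unitaryGroup p)) (λ g → ρ g , isUnitary g)

permutationGroup : Set → Group 0ℓ 0ℓ
permutationGroup A = record
  { Carrier = A ↔ A
  ; _≈_     = λ ψ χ → to ψ ≗ to χ
  ; _∙_     = _↔-∘_
  ; ε       = ↔-id A
  ; _⁻¹     = ↔-sym
  ; isGroup = record
    { isMonoid = record
      { isSemigroup = record
        { isMagma = record
          { isEquivalence = record
            { refl  = λ _ → refl
            ; sym   = λ ψ≗χ w → sym (ψ≗χ w)
            ; trans = λ ψ≗χ χ≗ω w → trans (ψ≗χ w) (χ≗ω w)
            }
          ; ∙-cong = λ {ψ} {_} {_} {χ′} ψ≗ψ′ χ≗χ′ w →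
              trans (cong (to ψ) (χ≗χ′ w)) (ψ≗ψ′ (to χ′ w))
          }
        ; assoc = λ _ _ _ _ → refl
        }
      ; identity = (λ _ _ → refl) , (λ _ _ → refl)
      }
    ; inverse = strictlyInverseʳ , strictlyInverseˡ
    ; ⁻¹-cong = λ {ψ} {χ} ψ≗χ w → begin
        from ψ w                    ≡⟨ cong (from ψ) (strictlyInverseˡ χ w) ⟨
        from ψ (to χ (from χ w))    ≡⟨ cong (from ψ) (ψ≗χ (from χ w)) ⟨
        from ψ (to ψ (from χ w))    ≡⟨ strictlyInverseʳ ψ (from χ w) ⟩
        from χ w                    ∎
    }
  }
  where
  open Inverse using (to; from; strictlyInverseˡ; strictlyInverseʳ)
  open ≡-Reasoning

module _ {c ℓ s} (G : Group c ℓ) (S : Pred (Group.Carrier G) s) where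
  open Group G renaming (_≈_ to _≈ᴳ_)

  data Generated : Pred Carrier (c ⊔ ℓ ⊔ s) where
    generator  : ∀ {g} → S g → Generated g
    ε-closed   : Generated ε
    ∙-closed   : ∀ {g h} → Generated g → Generated h → Generated (g ∙ h)
    ⁻¹-closed  : ∀ {g} → Generated g → Generated (g ⁻¹)
    ≈-closed   : ∀ {g h} → g ≈ᴳ h → Generated g → Generated h

  generatedSubgroup : Group (c ⊔ ℓ ⊔ s) ℓ
  generatedSubgroup = record
    { Carrier = ∃ Generated
    ; _≈_     = λ (g , _) (h , _) → g ≈ᴳ h
    ; _∙_     = λ (g , g∈) (h , h∈) → g ∙ h , ∙-closed g∈ h∈
    ; ε       = ε , ε-closed
    ; _⁻¹     = λ (g , g∈) → g ⁻¹ , ⁻¹-closed g∈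
    ; isGroup = record
      { isMonoid = record
        { isSemigroup = record
          { isMagma = record
            { isEquivalence = record
              { refl = Group.refl G ; sym = Group.sym G ; trans = Group.trans G }
            ; ∙-cong = ∙-cong
            }
          ; assoc = λ (g , _) (h , _) (k , _) → assoc g h k
          }
        ; identity = (λ (g , _) → identityˡ g) , (λ (g , _) → identityʳ g)
        }
      ; inverse = (λ (g , _) → inverseˡ g) , (λ (g , _) → inverseʳ g)
      ; ⁻¹-cong = ⁻¹-cong
      }
    }

private

  take-++ : ∀ {a b} (u : 𝔹 a) (v : 𝔹 b) → take a (u ++ v) ≡ u
  take-++ []      v = refl
  take-++ (b ∷ u) v = cong (b ∷_) (take-++ u v)

  drop-++ : ∀ {a b} (u : 𝔹 a) (v : 𝔹 b) → drop a (u ++ v) ≡ v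
  drop-++ []      v = refl
  drop-++ (b ∷ u) v = drop-++ u v

module _ {n m k : ℕ} where

  onBlocks : {A : Set} → (𝔹 n → 𝔹 m → 𝔹 k → A) → 𝔹 (n ℕ.+ (m ℕ.+ k)) → A
  onBlocks h w = h (take n w) (take m (drop n w)) (drop m (drop n w))

  onBlocks-++ : ∀ {A : Set} (h : 𝔹 n → 𝔹 m → 𝔹 k → A) x y z →
                onBlocks h (x ++ y ++ z) ≡ h x y z
  onBlocks-++ h x y z
    rewrite take-++ x (y ++ z) | drop-++ x (y ++ z) | take-++ y z | drop-++ y z = refl

  private

    blocks : ∀ w → onBlocks (λ x y z → x ++ y ++ z) w ≡ w
    blocks w = trans (cong (take n w ++_) (Vec.take++drop≡id m (drop n w)))
                     (Vec.take++drop≡id n w)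

    ⊕-involutive : ∀ {p} (y a : 𝔹 p) → y ⊕ a ⊕ a ≡ y
    ⊕-involutive []      []      = refl
    ⊕-involutive (b ∷ y) (c ∷ a) = cong₂ _∷_ (xor-involutive b c) (⊕-involutive y a)
      where
      xor-involutive : ∀ b c → (b xor c) xor c ≡ b
      xor-involutive false c     = Bool.xor-same c
      xor-involutive true  false = refl
      xor-involutive true  true  = refl

    involution : (h : 𝔹 (n ℕ.+ (m ℕ.+ k)) → 𝔹 (n ℕ.+ (m ℕ.+ k))) →
                 (∀ (x : 𝔹 n) (y : 𝔹 m) (z : 𝔹 k) → h (h (x ++ y ++ z)) ≡ x ++ y ++ z) →
                 𝔹 (n ℕ.+ (m ℕ.+ k)) ↔ 𝔹 (n ℕ.+ (m ℕ.+ k))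
    involution h hh = mk↔ₛ′ h h hh≡id hh≡id
      where
      hh≡id : ∀ w → h (h w) ≡ w
      hh≡id w = subst (λ w → h (h w) ≡ w) (blocks w)
        (hh (take n w) (take m (drop n w)) (drop m (drop n w)))

  φ : (𝔹 n → 𝔹 m) → 𝔹 (n ℕ.+ (m ℕ.+ k)) ↔ 𝔹 (n ℕ.+ (m ℕ.+ k))
  φ f = involution (onBlocks φ′) λ x y z → begin
    onBlocks φ′ (onBlocks φ′ (x ++ y ++ z))  ≡⟨ cong (onBlocks φ′) (onBlocks-++ φ′ x y z) ⟩
    onBlocks φ′ (x ++ (y ⊕ f x) ++ z)        ≡⟨ onBlocks-++ φ′ x (y ⊕ f x) z ⟩
    x ++ (y ⊕ f x ⊕ f x) ++ z                ≡⟨ cong (λ y → x ++ y ++ z) (⊕-involutive y (f x)) ⟩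
    x ++ y ++ z                              ∎
    where
    open ≡-Reasoning
    φ′ : 𝔹 n → 𝔹 m → 𝔹 k → 𝔹 (n ℕ.+ (m ℕ.+ k))
    φ′ x y z = x ++ (y ⊕ f x) ++ z

  γ : (𝔹 m → 𝔹 k) → 𝔹 (n ℕ.+ (m ℕ.+ k)) ↔ 𝔹 (n ℕ.+ (m ℕ.+ k))
  γ g = involution (onBlocks γ′) λ x y z → begin
    onBlocks γ′ (onBlocks γ′ (x ++ y ++ z))  ≡⟨ cong (onBlocks γ′) (onBlocks-++ γ′ x y z) ⟩
    onBlocks γ′ (x ++ y ++ (z ⊕ g y))        ≡⟨ onBlocks-++ γ′ x y (z ⊕ g y) ⟩
    x ++ y ++ (z ⊕ g y ⊕ g y)                ≡⟨ cong (λ z → x ++ y ++ z) (⊕-involutive z (g y)) ⟩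
    x ++ y ++ z                              ∎
    where
    open ≡-Reasoning
    γ′ : 𝔹 n → 𝔹 m → 𝔹 k → 𝔹 (n ℕ.+ (m ℕ.+ k))
    γ′ x y z = x ++ y ++ (z ⊕ g y)

  φ-++ : ∀ f x y z → Inverse.to (φ f) (x ++ y ++ z) ≡ x ++ (y ⊕ f x) ++ z
  φ-++ f = onBlocks-++ (λ x y z → x ++ (y ⊕ f x) ++ z)

  γ-++ : ∀ g x y z → Inverse.to (γ g) (x ++ y ++ z) ≡ x ++ y ++ (z ⊕ g y)
  γ-++ g = onBlocks-++ (λ x y z → x ++ y ++ (z ⊕ g y))

  G₂ₛ : (𝔹 n → 𝔹 m) → (𝔹 m → 𝔹 k) → Group 0ℓ 0ℓ
  G₂ₛ f g = generatedSubgroup (permutationGroup (𝔹 (n ℕ.+ (m ℕ.+ k))))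
    (λ ψ → ψ ≡ φ f ⊎ ψ ≡ γ g)

-- The linear extension of ∣ w ⟩ ↦ ∣ ψ w ⟩; see U-isLinear, U-∣x⟩∣y⟩∣z⟩
-- and U-unique.

U : ∀ {p} → (𝔹 p → 𝔹 p) → ⨂ℂ² p → ⨂ℂ² p
U ψ v w′ = ∑ (λ w → v w * ∣ ψ w ⟩ w′)

∑-+ : ∀ {p} (h k : 𝔹 p → ℂ) → ∑ (λ w → h w + k w) ≈ ∑ h + ∑ k
∑-+ {zero}  h k = ℂ-ring.refl
∑-+ {suc p} h k = ℂ-ring.trans
  (ℂ-ring.+-cong (∑-+ (λ w → h (false ∷ w)) (λ w → k (false ∷ w)))
                 (∑-+ (λ w → h (true  ∷ w)) (λ w → k (true  ∷ w))))
  (interchange _ _ _ _)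
  where open CommutativeSemigroupProperties ℂ-ring.+-commutativeSemigroup using (interchange)

∑-* : ∀ {p} a (h : 𝔹 p → ℂ) → ∑ (λ w → a * h w) ≈ a * ∑ h
∑-* {zero}  a h = ℂ-ring.refl
∑-* {suc p} a h = ℂ-ring.trans
  (ℂ-ring.+-cong (∑-* a (λ w → h (false ∷ w))) (∑-* a (λ w → h (true ∷ w))))
  (ℂ-ring.sym (ℂ-ring.distribˡ a _ _))

∑-neg : ∀ {p} (h : 𝔹 p → ℂ) → ∑ (λ w → - h w) ≈ - ∑ h
∑-neg {zero}  h = ℂ-ring.refl
∑-neg {suc p} h = ℂ-ring.trans
  (ℂ-ring.+-cong (∑-neg (λ w → h (false ∷ w))) (∑-neg (λ w → h (true ∷ w))))
  (-‿+-comm _ _)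
  where open RingProperties ℂ-ring.ring using (-‿+-comm)

module _ {p} (ψ : 𝔹 p → 𝔹 p) where

  U-isLinear : IsLinear (U ψ)
  U-isLinear = record
    { +ᴹ-isGroupHomomorphism = record
      { isMonoidHomomorphism = record
        { isMagmaHomomorphism = record
          { isRelHomomorphism = record
            { cong = λ u≈v w′ → ∑-cong λ w → ℂ-ring.*-congʳ (u≈v w) }
          ; homo = λ u v w′ → ℂ-ring.trans
              (∑-cong λ w → ℂ-ring.distribʳ (∣ ψ w ⟩ w′) (u w) (v w))
              (∑-+ (λ w → u w * ∣ ψ w ⟩ w′) (λ w → v w * ∣ ψ w ⟩ w′))
          }
        ; ε-homo = λ w′ → ∑-0 λ w → ℂ-ring.zeroˡ (∣ ψ w ⟩ w′)
        }
      ; ⁻¹-homo = λ v w′ → ℂ-ring.trans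
          (∑-cong λ w → ℂ-ring.sym (-‿distribˡ-* (v w) (∣ ψ w ⟩ w′)))
          (∑-neg (λ w → v w * ∣ ψ w ⟩ w′))
      }
    ; *ₗ-homo = λ a v w′ → ℂ-ring.trans
        (∑-cong λ w → ℂ-ring.*-assoc a (v w) (∣ ψ w ⟩ w′))
        (∑-* a (λ w → v w * ∣ ψ w ⟩ w′))
    }
    where open RingProperties ℂ-ring.ring using (-‿distribˡ-*)

  U-∣⟩ : ∀ w → U ψ ∣ w ⟩ ≈ᵛ ∣ ψ w ⟩
  U-∣⟩ w w′ = ∑-∣⟩ w (λ w → ∣ ψ w ⟩ w′)

  U-unique : ∀ {T} → IsLinear T → (∀ w → T ∣ w ⟩ ≈ᵛ ∣ ψ w ⟩) → ∀ v → T v ≈ᵛ U ψ v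
  U-unique {T} T-linear T-∣⟩ v = begin
    T v                                        ≈⟨ ⟦⟧-cong expand ⟩
    T (λ w′ → ∑ (λ w → v w * ∣ w ⟩ w′))        ≈⟨ T-∑ v ∣_⟩ ⟩
    (λ w′ → ∑ (λ w → v w * T ∣ w ⟩ w′))        ≈⟨ (λ w′ → ∑-cong λ w → ℂ-ring.*-congˡ (T-∣⟩ w w′)) ⟩
    U ψ v                                      ∎
    where
    open IsLinear T-linear
    open LeftModule (⨂ℂ²-leftModule p) using (≈ᴹ-setoid; ≈ᴹ-trans; +ᴹ-cong)
    open import Relation.Binary.Reasoning.Setoid ≈ᴹ-setoid

    ∣⟩-sym : ∀ {q} (x y : 𝔹 q) → ∣ x ⟩ y ≈ ∣ y ⟩ x
    ∣⟩-sym []          []          = ℂ-ring.refl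
    ∣⟩-sym (false ∷ x) (true  ∷ y) = ℂ-ring.trans (ℂ-ring.zeroˡ _) (ℂ-ring.sym (ℂ-ring.zeroˡ _))
    ∣⟩-sym (true  ∷ x) (false ∷ y) = ℂ-ring.trans (ℂ-ring.zeroˡ _) (ℂ-ring.sym (ℂ-ring.zeroˡ _))
    ∣⟩-sym (false ∷ x) (false ∷ y) = ℂ-ring.*-congˡ (∣⟩-sym x y)
    ∣⟩-sym (true  ∷ x) (true  ∷ y) = ℂ-ring.*-congˡ (∣⟩-sym x y)

    expand : v ≈ᵛ λ w′ → ∑ (λ w → v w * ∣ w ⟩ w′)
    expand w′ = ℂ-ring.sym (ℂ-ring.trans
      (∑-cong λ w → ℂ-ring.trans (ℂ-ring.*-congˡ (∣⟩-sym w w′)) (ℂ-ring.*-comm _ _))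
      (∑-∣⟩ w′ v))

    T-∑ : ∀ {q} (a : 𝔹 q → ℂ) (e : 𝔹 q → ⨂ℂ² p) →
          T (λ w′ → ∑ (λ w → a w * e w w′)) ≈ᵛ λ w′ → ∑ (λ w → a w * T (e w) w′)
    T-∑ {zero}  a e = *ₗ-homo (a []) (e [])
    T-∑ {suc q} a e = ≈ᴹ-trans (+ᴹ-homo _ _)
      (+ᴹ-cong (T-∑ (λ w → a (false ∷ w)) (λ w → e (false ∷ w)))
               (T-∑ (λ w → a (true  ∷ w)) (λ w → e (true  ∷ w))))

U-∣x⟩∣y⟩∣z⟩ : ∀ {n m k} (ψ : 𝔹 (n ℕ.+ (m ℕ.+ k)) → 𝔹 (n ℕ.+ (m ℕ.+ k)))
  {x x′ : 𝔹 n} {y y′ : 𝔹 m} {z z′ : 𝔹 k} → ψ (x ++ y ++ z) ≡ x′ ++ y′ ++ z′ →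
  U ψ (∣ x ⟩ ⊗ ∣ y ⟩ ⊗ ∣ z ⟩) ≈ᵛ ∣ x′ ⟩ ⊗ ∣ y′ ⟩ ⊗ ∣ z′ ⟩
U-∣x⟩∣y⟩∣z⟩ {n} {m} {k} ψ {x} {x′} {y} {y′} {z} {z′} ψ-eq = begin
  U ψ (∣ x ⟩ ⊗ ∣ y ⟩ ⊗ ∣ z ⟩)  ≈⟨ IsLinear.⟦⟧-cong (U-isLinear ψ) (∣⟩-++₃ x y z) ⟨
  U ψ ∣ x ++ y ++ z ⟩          ≈⟨ U-∣⟩ ψ (x ++ y ++ z) ⟩
  ∣ ψ (x ++ y ++ z) ⟩          ≡⟨ cong ∣_⟩ ψ-eq ⟩
  ∣ x′ ++ y′ ++ z′ ⟩           ≈⟨ ∣⟩-++₃ x′ y′ z′ ⟩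
  ∣ x′ ⟩ ⊗ ∣ y′ ⟩ ⊗ ∣ z′ ⟩     ∎
  where
  open LeftModule (⨂ℂ²-leftModule (n ℕ.+ (m ℕ.+ k))) using (≈ᴹ-setoid)
  open import Relation.Binary.Reasoning.Setoid ≈ᴹ-setoid

  ∣⟩-++₃ : ∀ x y z → ∣ x ++ y ++ z ⟩ ≈ᵛ ∣ x ⟩ ⊗ ∣ y ⟩ ⊗ ∣ z ⟩
  ∣⟩-++₃ x y z w = ℂ-ring.trans (∣⟩-++ x (y ++ z) w)
    (ℂ-ring.*-congˡ (∣⟩-++ y z (drop n w)))

{-# OPTIONS --safe #-}

-- In coordinates U ψ v is v ∘ ψ⁻¹.  Hence ψ ↦ U ψ is multiplicative and
-- U ψ⁻¹ inverts U ψ, while the inner product is preserved because a sum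
-- over all bit strings is unchanged by reindexing along ψ.

module Submission where

open import Defs
open import Algebra.Bundles using (CommutativeRing)
open import Data.Bool.Base using (true; false)
import Data.Bool.Properties as Bool
open import Data.Nat.Base using (ℕ; zero; suc; NonZero)
open import Data.Product.Base using (_,_)
open import Data.Vec.Base using (_∷_)
open import Data.Vec.Properties using (≡-dec)
open import Function.Base using (_∘_)
open import Function.Bundles using (_↔_; module Inverse)
open import Function.Construct.Composition using (_↔-∘_)
open import Function.Construct.Identity using (↔-id)
open import Function.Construct.Symmetry using (↔-sym)
open import Relation.Binary.PropositionalEquality using (_≗_; refl; cong)
open import Relation.Nullary.Decidable using (yes; no)

open CommutativeRing ℂ-commutativeRing hiding (refl; zero)

private
  module ℂ-ring = CommutativeRing ℂ-commutativeRing

open import Relation.Binary.Reasoning.Setoid setoid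

∑-swap : ∀ {p q} (h : 𝔹 p → 𝔹 q → ℂ) →
         ∑ (λ w → ∑ (h w)) ≈ ∑ (λ w′ → ∑ (λ w → h w w′))
∑-swap {zero}  h = ℂ-ring.refl
∑-swap {suc p} h = trans
  (+-cong (∑-swap (λ w → h (false ∷ w))) (∑-swap (λ w → h (true ∷ w))))
  (sym (∑-+ (λ w′ → ∑ (λ w → h (false ∷ w) w′)) (λ w′ → ∑ (λ w → h (true ∷ w) w′))))

∑-∣⟩-1 : ∀ {p} (x : 𝔹 p) → ∑ ∣ x ⟩ ≈ 1#
∑-∣⟩-1 x = trans (∑-cong λ w → sym (*-identityʳ (∣ x ⟩ w))) (∑-∣⟩ x (λ _ → 1#))

-- `U ψ` pushes amplitudes forward along `ψ`, and every basis vector has coordinate sum 1, so the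
-- total is kept. For a bijection this becomes the reindexing of sums.
∑-U : ∀ {p} (ψ : 𝔹 p → 𝔹 p) v → ∑ (U ψ v) ≈ ∑ v
∑-U ψ v = begin
  ∑ (λ w′ → ∑ (λ w → v w * ∣ ψ w ⟩ w′))  ≈⟨ ∑-swap (λ w′ w → v w * ∣ ψ w ⟩ w′) ⟩
  ∑ (λ w → ∑ (λ w′ → v w * ∣ ψ w ⟩ w′))  ≈⟨ ∑-cong (λ w → ∑-* (v w) ∣ ψ w ⟩) ⟩
  ∑ (λ w → v w * ∑ ∣ ψ w ⟩)              ≈⟨ ∑-cong (λ w → *-congˡ (∑-∣⟩-1 (ψ w))) ⟩
  ∑ (λ w → v w * 1#)                     ≈⟨ ∑-cong (λ w → *-identityʳ (v w)) ⟩
  ∑ v                                    ∎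

U-≗ : ∀ {p} {ψ χ : 𝔹 p → 𝔹 p} → ψ ≗ χ → ∀ v → U ψ v ≈ᵛ U χ v
U-≗ ψ≗χ v w′ = ∑-cong λ w → reflexive (cong (λ x → v w * ∣ x ⟩ w′) (ψ≗χ w))

module _ {p : ℕ} (ψ : 𝔹 p ↔ 𝔹 p) where
  open Inverse ψ using (to; from; strictlyInverseˡ; strictlyInverseʳ)

  -- Both entries are 1 or 0 according to whether `to w` equals `w′`, which holds exactly when
  -- `from w′` equals `w`. So the inverse permutation has the transposed matrix.
  ∣⟩-adjoint : ∀ w w′ → ∣ to w ⟩ w′ ≈ ∣ from w′ ⟩ w
  ∣⟩-adjoint w w′ with ≡-dec Bool._≟_ (to w) w′
  ... | yes refl rewrite strictlyInverseʳ w =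
    trans (∣⟩-same (to w)) (sym (∣⟩-same w))
  ... | no to-w≢w′ = trans (∣⟩-distinct (to w) w′ to-w≢w′) (sym
    (∣⟩-distinct (from w′) w λ { refl → to-w≢w′ (strictlyInverseˡ w′) }))

  -- Once the entries are transposed, the sum pairs `v` with the basis vector at `from w′`, which
  -- picks out a single amplitude. This form reduces inverses and composites to the laws of
  -- bijections.
  U-from : ∀ v → U to v ≈ᵛ v ∘ from
  U-from v w′ = begin
    ∑ (λ w → v w * ∣ to w ⟩ w′)     ≈⟨ ∑-cong (λ w → *-congˡ (∣⟩-adjoint w w′)) ⟩
    ∑ (λ w → v w * ∣ from w′ ⟩ w)   ≈⟨ ∑-cong (λ w → *-comm (v w) (∣ from w′ ⟩ w)) ⟩
    ∑ (λ w → ∣ from w′ ⟩ w * v w)   ≈⟨ ∑-∣⟩ (from w′) v ⟩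
    v (from w′)                     ∎

  U-⟨⟩ : ∀ u v → ⟨ U to u , U to v ⟩ ≈ ⟨ u , v ⟩
  U-⟨⟩ u v = begin
    ⟨ U to u , U to v ⟩                      ≈⟨ ⟨⟩-cong (U-from u) (U-from v) ⟩
    -- The summand is itself regarded as a vector, so `U-from` read backwards turns the reindexing
    -- by `from` into an application of `U to`, to which `∑-U` applies.
    ∑ ((λ w → conj (u w) * v w) ∘ from)      ≈⟨ ∑-cong (U-from (λ w → conj (u w) * v w)) ⟨
    ∑ (U to (λ w → conj (u w) * v w))        ≈⟨ ∑-U to (λ w → conj (u w) * v w) ⟩
    ⟨ u , v ⟩                                ∎

U-inverse : ∀ {p} (ψ : 𝔹 p ↔ 𝔹 p) v → U (Inverse.from ψ) (U (Inverse.to ψ) v) ≈ᵛ v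
U-inverse ψ v w = begin
  U from (U to v) w  ≈⟨ U-from (↔-sym ψ) (U to v) w ⟩
  U to v (to w)      ≈⟨ U-from ψ v (to w) ⟩
  v (from (to w))    ≡⟨ cong v (strictlyInverseʳ w) ⟩
  v w                ∎
  where open Inverse ψ using (to; from; strictlyInverseʳ)

U-isUnitary : ∀ {p} (ψ : 𝔹 p ↔ 𝔹 p) → IsUnitary (U (Inverse.to ψ))
U-isUnitary ψ = record
  { isLinearIsomorphism = record
    { isLeftModuleMonomorphism = record
      { isLeftModuleHomomorphism = U-isLinear to
      ; injective = λ {u} {v} Uu≈Uv w → begin
          u w                ≈⟨ U-inverse ψ u w ⟨
          U from (U to u) w  ≈⟨ IsLinear.⟦⟧-cong (U-isLinear from) Uu≈Uv w ⟩
          U from (U to v) w  ≈⟨ U-inverse ψ v w ⟩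
          v w                ∎
      }
    -- Every `u` equal to the chosen preimage must map to `v`, hence the congruence before
    -- `U-inverse` for the inverse bijection.
    ; surjective = λ v → U from v , λ {u} u≈ w →
        trans (IsLinear.⟦⟧-cong (U-isLinear to) u≈ w) (U-inverse (↔-sym ψ) v w)
    }
  ; ⟨⟩-homo = U-⟨⟩ ψ
  }
  where open Inverse ψ using (to; from)

U-∘ : ∀ {p} (ψ χ : 𝔹 p ↔ 𝔹 p) v →
      U (Inverse.to ψ ∘ Inverse.to χ) v ≈ᵛ U (Inverse.to ψ) (U (Inverse.to χ) v)
U-∘ ψ χ v w = begin
  U (ψ.to ∘ χ.to) v w    ≈⟨ U-from (ψ ↔-∘ χ) v w ⟩
  v (χ.from (ψ.from w))  ≈⟨ U-from χ v (ψ.from w) ⟨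
  U χ.to v (ψ.from w)    ≈⟨ U-from ψ (U χ.to v) w ⟨
  U ψ.to (U χ.to v) w    ∎
  where
  module ψ = Inverse ψ
  module χ = Inverse χ

U-id : ∀ {p} (v : ⨂ℂ² p) → U (λ w → w) v ≈ᵛ v
U-id = U-from (↔-id _)

proposition2 : ∀ (n m k : ℕ) .{{_ : NonZero n}} .{{_ : NonZero m}} .{{_ : NonZero k}}
    (f : 𝔹 n → 𝔹 m) (g : 𝔹 m → 𝔹 k) →
    IsUnitaryRepresentation (G₂ₛ f g) (λ (ψ , _) → U (Inverse.to ψ))
proposition2 n m k f g = record
  { isUnitary = λ (ψ , _) → U-isUnitary ψ
  ; isGroupHomomorphism = record
    { isMonoidHomomorphism = record
      { isMagmaHomomorphism = record
        { isRelHomomorphism = record { cong = U-≗ }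
        ; homo = λ (ψ , _) (χ , _) → U-∘ ψ χ
        }
      ; ε-homo = U-id
      }
    -- The inverse in `unitaryGroup` is the preimage chosen by `surjective`, here `U from`, and
    -- `from` is the forward map of `↔-sym ψ`; both sides agree by definition.
    ; ⁻¹-homo = λ _ _ _ → ℂ-ring.refl
    }
  }
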